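{- Let $K$ be a number field. The following statements hold. 1. $\mathcal{C}(T_n)=I_n$ for every non-singular (upper or lower) triangular $n\times n$ matrix $T_n$ over $K$. 2. For every such $T_n$, the set of eigenvalues of $\mathcal{C}(T_n)$ is $\Lambda(\mathcal{C}(T_n))=\{1\}$. 3. $\mathcal{C}(AB)=\mathcal{C}(A)\mathcal{C}(B)$ for all non-singular triangular $n\times n$ matrices $A,B$ over $K$.
   Context: $\circ$ denotes the Hadamard (entrywise) product; the combined matrix of a non-singular matrix $A$ is $\mathcal{C}(A)=A\circ (A^{ -1})^T$. $I_n$ is the $n\times n$ identity matrix. A triangular matrix is one that is upper triangular or lower triangular.
   Formalization: In part 3, A and B are assumed to be both upper triangular or both lower triangular; for one lower and one upper factor the claim is false, e.g. A=[[1,0],[1,1]], B=[[1,1],[0,1]] gives C(AB)=[[2,-1],[-1,2]], not I. Also n is at least 1. -}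

module Defs where

open import Algebra.Apartness.Bundles using (HeytingField; HeytingCommutativeRing)
open import Algebra.Bundles using (CommutativeRing)
import Algebra.Definitions
open import Algebra.Morphism.Structures using (module RingMorphisms)
import Algebra.Properties.Semiring.Sum
open import Data.Bool.Base using (if_then_else_)
open import Data.Fin.Base using (Fin; zero; suc; _<_)
open import Data.Fin.Properties using (_≟_)
open import Data.Nat.Base using (ℕ; zero; suc)
open import Data.Product.Base using (Σ-syntax; ∃-syntax; _×_; _,_)
open import Data.Rational.Base using (ℚ; 0ℚ)
import Data.Rational.Properties as ℚ
open import Data.Sum.Base using (_⊎_)
open import Data.Vec.Functional using (Vector; map; zipWith; transpose)
open import Level using (_⊔_) renaming (suc to lsuc)
import Relation.Binary.Reasoning.Setoid
open import Relation.Binary.PropositionalEquality.Core using (_≡_)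
open import Relation.Nullary.Decidable.Core using (does)
open import Relation.Unary using (Pred)

ringOf : ∀ {c ℓ₁ ℓ₂} → HeytingField c ℓ₁ ℓ₂ → CommutativeRing c ℓ₁
ringOf F = HeytingCommutativeRing.commutativeRing (HeytingField.heytingCommutativeRing F)

-- A ring homomorphism between fields is automatically injective.
record Extension {a ℓ₁ ℓ₂} (F : HeytingField a ℓ₁ ℓ₂) c m₁ m₂
       : Set (a ⊔ ℓ₁ ⊔ lsuc (c ⊔ m₁ ⊔ m₂)) where
  field
    overfield : HeytingField c m₁ m₂
    embed : HeytingField.Carrier F → HeytingField.Carrier overfield
    embed-isRingHomomorphism :
      RingMorphisms.IsRingHomomorphism
        (CommutativeRing.rawRing (ringOf F)) (CommutativeRing.rawRing (ringOf overfield)) embed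

-- A field of finite degree over ℚ. Constructively, finite dimension is given
-- by a basis, which also makes equality decidable.
record NumberField c ℓ₁ ℓ₂ : Set (lsuc (c ⊔ ℓ₁ ⊔ ℓ₂)) where
  field
    extension : Extension ℚ.heytingField c ℓ₁ ℓ₂

  open Extension extension public renaming (overfield to heytingField)
  open HeytingField heytingField using (Carrier; _≈_; _*_; 0#)
  open Algebra.Properties.Semiring.Sum (CommutativeRing.semiring (ringOf heytingField))
    using (sum-syntax)

  field
    degree      : ℕ
    basis       : Vector Carrier degree
    spanning    : ∀ x → Σ[ q ∈ Vector ℚ degree ] x ≈ ∑[ i < degree ] (embed (q i) * basis i)
    independent : ∀ (q : Vector ℚ degree) →
                  ∑[ i < degree ] (embed (q i) * basis i) ≈ 0# → ∀ i → q i ≡ 0ℚ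

module Matrices {c ℓ₁ ℓ₂} (F : HeytingField c ℓ₁ ℓ₂) where

  open HeytingField F using (_#_)
  open CommutativeRing (ringOf F) hiding (zero)
  open Algebra.Properties.Semiring.Sum semiring

  infix  4 _≈ᴹ_
  infixl 7 _*ᴹ_ _∘ᴹ_

  Matrix : ℕ → Set c
  Matrix n = Vector (Vector Carrier n) n

  _≈ᴹ_ : ∀ {n} → Matrix n → Matrix n → Set ℓ₁
  A ≈ᴹ B = ∀ i j → A i j ≈ B i j

  Iᴹ : ∀ n → Matrix n
  Iᴹ n i j = if does (i ≟ j) then 1# else 0#

  _*ᴹ_ : ∀ {n} → Matrix n → Matrix n → Matrix n
  _*ᴹ_ {n} A B i j = ∑[ k < n ] (A i k * B k j)

  _∘ᴹ_ : ∀ {n} → Matrix n → Matrix n → Matrix n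
  _∘ᴹ_ = zipWith (zipWith _*_)

  NonSingular : ∀ {n} → Matrix n → Set (c ⊔ ℓ₁)
  NonSingular {n} = Algebra.Definitions.Invertible _≈ᴹ_ (Iᴹ n) _*ᴹ_

  combined : ∀ {n} (A : Matrix n) → NonSingular A → Matrix n
  combined A (A⁻¹ , _) = A ∘ᴹ transpose A⁻¹

  UpperTriangular : ∀ {n} → Matrix n → Set ℓ₁
  UpperTriangular A = ∀ i j → j < i → A i j ≈ 0#

  LowerTriangular : ∀ {n} → Matrix n → Set ℓ₁
  LowerTriangular A = ∀ i j → i < j → A i j ≈ 0#

  Triangular : ∀ {n} → Matrix n → Set ℓ₁
  Triangular A = UpperTriangular A ⊎ LowerTriangular A

  -- The eigenvalues in F. A vector is nonzero when some entry is apart from 0.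
  Eigenvalue : ∀ {n} → Matrix n → Pred Carrier (c ⊔ ℓ₁ ⊔ ℓ₂)
  Eigenvalue {n} A μ =
    Σ[ v ∈ Vector Carrier n ] (∃[ i ] v i # 0#) × (∀ i → ∑[ j < n ] (A i j * v j) ≈ μ * v i)

  private open module ≈-Reasoning = Relation.Binary.Reasoning.Setoid setoid

  *ᴹ-cong : ∀ {n} {A A′ B B′ : Matrix n} → A ≈ᴹ A′ → B ≈ᴹ B′ → A *ᴹ B ≈ᴹ A′ *ᴹ B′
  *ᴹ-cong p q i j = sum-cong-≋ λ k → *-cong (p i k) (q k j)

  *ᴹ-assoc : ∀ {n} (A B C : Matrix n) → (A *ᴹ B) *ᴹ C ≈ᴹ A *ᴹ (B *ᴹ C)
  *ᴹ-assoc {n} A B C i j = begin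
    ∑[ k < n ] (∑[ l < n ] (A i l * B l k) * C k j)
      ≈⟨ sum-cong-≋ (λ k → *-distribʳ-sum (C k j) (λ l → A i l * B l k)) ⟩
    ∑[ k < n ] ∑[ l < n ] (A i l * B l k * C k j)
      ≈⟨ sum-cong-≋ (λ k → sum-cong-≋ λ l → *-assoc (A i l) (B l k) (C k j)) ⟩
    ∑[ k < n ] ∑[ l < n ] (A i l * (B l k * C k j))
      ≈⟨ ∑-comm (λ k l → A i l * (B l k * C k j)) ⟩
    ∑[ l < n ] ∑[ k < n ] (A i l * (B l k * C k j))
      ≈⟨ sum-cong-≋ (λ l → *-distribˡ-sum (A i l) (λ k → B l k * C k j)) ⟨
    ∑[ l < n ] (A i l * ∑[ k < n ] (B l k * C k j)) ∎

  sum-Iᴹ : ∀ {n} (v : Vector Carrier n) i → ∑[ k < n ] (Iᴹ n i k * v k) ≈ v i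
  sum-Iᴹ {suc n} v zero = begin
    1# * v zero + ∑[ k < n ] (0# * v (suc k))
      ≈⟨ +-cong (*-identityˡ _) (trans (sum-cong-≋ λ k → zeroˡ (v (suc k))) (sum-replicate-zero n)) ⟩
    v zero + 0#  ≈⟨ +-identityʳ _ ⟩
    v zero       ∎
  sum-Iᴹ {suc n} v (suc i) = begin
    0# * v zero + ∑[ k < n ] (Iᴹ n i k * v (suc k))
      ≈⟨ +-cong (zeroˡ _) (sum-Iᴹ (λ k → v (suc k)) i) ⟩
    0# + v (suc i)  ≈⟨ +-identityˡ _ ⟩
    v (suc i)       ∎

  cancel-middle : ∀ {n} (A B C D : Matrix n) →
                  B *ᴹ C ≈ᴹ Iᴹ n → A *ᴹ D ≈ᴹ Iᴹ n → (A *ᴹ B) *ᴹ (C *ᴹ D) ≈ᴹ Iᴹ n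
  cancel-middle {n} A B C D BC≈I AD≈I i j = begin
    ((A *ᴹ B) *ᴹ (C *ᴹ D)) i j  ≈⟨ *ᴹ-assoc A B (C *ᴹ D) i j ⟩
    (A *ᴹ (B *ᴹ (C *ᴹ D))) i j  ≈⟨ A*ᴹ (λ k l → *ᴹ-assoc B C D k l) i j ⟨
    (A *ᴹ ((B *ᴹ C) *ᴹ D)) i j  ≈⟨ A*ᴹ (*ᴹ-cong {B = D} BC≈I (λ _ _ → refl)) i j ⟩
    (A *ᴹ (Iᴹ n *ᴹ D)) i j      ≈⟨ A*ᴹ (λ k l → sum-Iᴹ (λ m → D m l) k) i j ⟩
    (A *ᴹ D) i j                ≈⟨ AD≈I i j ⟩
    Iᴹ n i j                    ∎
    where
    A*ᴹ : ∀ {X Y : Matrix n} → X ≈ᴹ Y → A *ᴹ X ≈ᴹ A *ᴹ Y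
    A*ᴹ = *ᴹ-cong {A = A} (λ _ _ → refl)

  nonSingular-*ᴹ : ∀ {n} (A B : Matrix n) →
                   NonSingular A → NonSingular B → NonSingular (A *ᴹ B)
  nonSingular-*ᴹ A B (A⁻¹ , A⁻¹A≈I , AA⁻¹≈I) (B⁻¹ , B⁻¹B≈I , BB⁻¹≈I) =
    B⁻¹ *ᴹ A⁻¹ , cancel-middle B⁻¹ A⁻¹ A B A⁻¹A≈I B⁻¹B≈I
               , cancel-middle A B B⁻¹ A⁻¹ BB⁻¹≈I AA⁻¹≈I

-- The eigenvalues, in an extension field, of a matrix over the base field.
-- The spectrum over the base field itself is the case of the identity embedding.
module _ {a ℓ₁ ℓ₂ c m₁ m₂} {F : HeytingField a ℓ₁ ℓ₂} (L : Extension F c m₁ m₂) where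

  open Extension L

  Λ : ∀ {n} → Matrices.Matrix F n → Pred (HeytingField.Carrier overfield) (c ⊔ m₁ ⊔ m₂)
  Λ A = Matrices.Eigenvalue overfield (map (map embed) A)

{-# OPTIONS --safe #-}

-- If S T = I with T upper triangular, the first column of S T shows that S₀₀ T₀₀ = 1
-- and that S vanishes below S₀₀. So T ∘ Sᵀ agrees with I in the first row and column,
-- and deleting these from S and T leaves S′ T′ = I with T′ upper triangular. Lower
-- triangular matrices follow by transposition. The rest holds because the product of
-- two upper (lower) triangular matrices is again upper (lower) triangular.
module Submission where

open import Defs
open import Algebra.Apartness.Bundles using (HeytingField)
import Algebra.Apartness.Properties.HeytingCommutativeRing
open import Algebra.Bundles using (CommutativeRing)
open import Algebra.Morphism.Structures using (module RingMorphisms)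
import Algebra.Properties.Semiring.Sum
open import Data.Fin.Base using (zero; suc; fromℕ<)
open import Data.Fin.Properties using (_≟_; _<?_)
open import Data.Nat.Base using (ℕ; NonZero; z<s; s<s; >-nonZero⁻¹)
open import Data.Nat.Properties using (<-≤-trans; ≮⇒≥)
open import Data.Product.Base using (_×_; _,_)
open import Data.Sum.Base using (_⊎_; inj₁; inj₂)
open import Data.Vec.Functional using (Vector; map; transpose)
import Relation.Binary.Reasoning.Setoid
open import Relation.Nullary.Decidable.Core using (yes; no)
open import Relation.Unary using (_≐_)

module MatrixProperties {c ℓ₁ ℓ₂} (F : HeytingField c ℓ₁ ℓ₂) where

  open Matrices F
  open HeytingField F using (_#_; #⇒invertible; heytingCommutativeRing)
  open Algebra.Apartness.Properties.HeytingCommutativeRing heytingCommutativeRing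
    using (1#0; x-0≈x)
  open CommutativeRing (ringOf F) hiding (zero)
  open Algebra.Properties.Semiring.Sum semiring
  open Relation.Binary.Reasoning.Setoid setoid

  sum-zero : ∀ {n} {v : Vector Carrier n} → (∀ i → v i ≈ 0#) → sum v ≈ 0#
  sum-zero {n} v≈0 = trans (sum-cong-≋ v≈0) (sum-replicate-zero n)

  x*y≈0⇒x≈0 : ∀ {x y z} → z * y ≈ 1# → x * y ≈ 0# → x ≈ 0#
  x*y≈0⇒x≈0 {x} {y} {z} zy≈1 xy≈0 = begin
    x            ≈⟨ *-identityʳ x ⟨
    x * 1#       ≈⟨ *-congˡ (trans (*-comm y z) zy≈1) ⟨
    x * (y * z)  ≈⟨ *-assoc x y z ⟨
    x * y * z    ≈⟨ *-congʳ xy≈0 ⟩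
    0# * z       ≈⟨ zeroˡ z ⟩
    0#           ∎

  -- Apartness makes `y` a unit: `#⇒invertible` inverts the difference `y - 0#`, which equals `y`.
  x*y≈y⇒x≈1 : ∀ {x y} → y # 0# → x * y ≈ y → x ≈ 1#
  x*y≈y⇒x≈1 {x} {y} y#0 xy≈y with w , _ , [y-0]w≈1 ← #⇒invertible y#0 = begin
    x            ≈⟨ *-identityʳ x ⟨
    x * 1#       ≈⟨ *-congˡ yw≈1 ⟨
    x * (y * w)  ≈⟨ *-assoc x y w ⟨
    x * y * w    ≈⟨ *-congʳ xy≈y ⟩
    y * w        ≈⟨ yw≈1 ⟩
    1#           ∎
    where
    yw≈1 : y * w ≈ 1#
    yw≈1 = trans (*-congʳ (sym (x-0≈x y))) [y-0]w≈1

  Iᴹ-symmetric : ∀ {n} → transpose (Iᴹ n) ≈ᴹ Iᴹ n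
  Iᴹ-symmetric zero    zero    = refl
  Iᴹ-symmetric zero    (suc _) = refl
  Iᴹ-symmetric (suc _) zero    = refl
  Iᴹ-symmetric (suc i) (suc j) = Iᴹ-symmetric i j

  transpose-*ᴹ : ∀ {n} (A B : Matrix n) → transpose (A *ᴹ B) ≈ᴹ transpose B *ᴹ transpose A
  transpose-*ᴹ A B i j = sum-cong-≋ λ k → *-comm (A j k) (B k i)

  -- The term at `k` vanishes through `A` if `k < i`, and otherwise through `B`, since then
  -- `j < i ≤ k`.
  upperTriangular-*ᴹ : ∀ {n} (A B : Matrix n) →
                       UpperTriangular A → UpperTriangular B → UpperTriangular (A *ᴹ B)
  upperTriangular-*ᴹ A B A-upper B-upper i j j<i = sum-zero term≈0
    where
    term≈0 : ∀ k → A i k * B k j ≈ 0#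
    term≈0 k with k <? i
    ... | yes k<i = trans (*-congʳ (A-upper i k k<i)) (zeroˡ (B k j))
    ... | no  k≮i = trans (*-congˡ (B-upper k j (<-≤-trans j<i (≮⇒≥ k≮i)))) (zeroʳ (A i k))

  lowerTriangular-*ᴹ : ∀ {n} (A B : Matrix n) →
                       LowerTriangular A → LowerTriangular B → LowerTriangular (A *ᴹ B)
  lowerTriangular-*ᴹ A B A-lower B-lower i j i<j =
    trans (transpose-*ᴹ A B j i)
      (upperTriangular-*ᴹ (transpose B) (transpose A)
        (λ k l → B-lower l k) (λ k l → A-lower l k) j i i<j)

  triangular-*ᴹ : ∀ {n} (A B : Matrix n) →
                  (UpperTriangular A × UpperTriangular B) ⊎ (LowerTriangular A × LowerTriangular B) →
                  Triangular A × Triangular B × Triangular (A *ᴹ B)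
  triangular-*ᴹ A B (inj₁ (a , b)) = inj₁ a , inj₁ b , inj₁ (upperTriangular-*ᴹ A B a b)
  triangular-*ᴹ A B (inj₂ (a , b)) = inj₂ a , inj₂ b , inj₂ (lowerTriangular-*ᴹ A B a b)

  -- Induction on the size; a matrix of size zero has no entries to compare. The one-sided equation
  -- is all that has to be passed on to the smaller blocks.
  upperTriangular-∘ᴹ-leftInverse : ∀ {n} (S T : Matrix n) → S *ᴹ T ≈ᴹ Iᴹ n →
                                   UpperTriangular T → T ∘ᴹ transpose S ≈ᴹ Iᴹ n
  upperTriangular-∘ᴹ-leftInverse {ℕ.suc n} S T ST≈I T-upper = entry
    where
    column₀ : ∀ i → S i zero * T zero zero ≈ Iᴹ (ℕ.suc n) i zero
    column₀ i = begin
      S i zero * T zero zero       ≈⟨ +-identityʳ _ ⟨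
      S i zero * T zero zero + 0#  ≈⟨ +-congˡ (sum-zero λ k →
                                        trans (*-congˡ (T-upper (suc k) zero z<s)) (zeroʳ (S i (suc k)))) ⟨
      (S *ᴹ T) i zero              ≈⟨ ST≈I i zero ⟩
      Iᴹ (ℕ.suc n) i zero          ∎

    S₊₀≈0 : ∀ i → S (suc i) zero ≈ 0#
    -- `column₀ zero` exhibits `S zero zero` as an inverse of `T zero zero`, which can therefore be
    -- cancelled.
    S₊₀≈0 i = x*y≈0⇒x≈0 (column₀ zero) (column₀ (suc i))

    S′ T′ : Matrix n
    S′ i j = S (suc i) (suc j)
    T′ i j = T (suc i) (suc j)

    S′T′≈I : S′ *ᴹ T′ ≈ᴹ Iᴹ n
    S′T′≈I i j = begin
      (S′ *ᴹ T′) i j               ≈⟨ +-identityˡ _ ⟨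
      0# + (S′ *ᴹ T′) i j          ≈⟨ +-congʳ (trans (*-congʳ (S₊₀≈0 i)) (zeroˡ (T zero (suc j)))) ⟨
      (S *ᴹ T) (suc i) (suc j)     ≈⟨ ST≈I (suc i) (suc j) ⟩
      Iᴹ n i j                     ∎

    entry : T ∘ᴹ transpose S ≈ᴹ Iᴹ (ℕ.suc n)
    entry zero    zero    = trans (*-comm (T zero zero) (S zero zero)) (column₀ zero)
    entry zero    (suc j) = trans (*-congˡ (S₊₀≈0 j)) (zeroʳ (T zero (suc j)))
    entry (suc i) zero    = trans (*-congʳ (T-upper (suc i) zero z<s)) (zeroˡ (S zero (suc i)))
    entry (suc i) (suc j) =
      upperTriangular-∘ᴹ-leftInverse S′ T′ S′T′≈I (λ k l l<k → T-upper (suc k) (suc l) (s<s l<k)) i j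

  -- The upper case uses `S` as a left inverse. The lower case uses it as a right inverse, because
  -- transposing `T *ᴹ S ≈ᴹ Iᴹ n` makes `transpose S` a left inverse of `transpose T`.
  combined-triangular : ∀ {n} (T : Matrix n) (T-ns : NonSingular T) →
                        Triangular T → combined T T-ns ≈ᴹ Iᴹ n
  combined-triangular T (S , ST≈I , _) (inj₁ T-upper) =
    upperTriangular-∘ᴹ-leftInverse S T ST≈I T-upper
  combined-triangular {n} T (S , _ , TS≈I) (inj₂ T-lower) i j =
    -- The entry at `j i` for the transposes is `T i j * S j i`, the wanted entry at `i j`.
    trans (upperTriangular-∘ᴹ-leftInverse (transpose S) (transpose T) SᵀTᵀ≈I
             (λ k l → T-lower l k) j i)
          (Iᴹ-symmetric i j)
    where
    SᵀTᵀ≈I : transpose S *ᴹ transpose T ≈ᴹ Iᴹ n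
    SᵀTᵀ≈I k l = trans (sym (transpose-*ᴹ T S k l)) (trans (TS≈I l k) (Iᴹ-symmetric k l))

  -- Both sides are the identity. The factors share a shape because mixed shapes fail: with rows (1,
  -- 1), (0, 1) for `A` and its transpose for `B`, the combined matrix of the product has rows (2,
  -- -1), (-1, 2).
  combined-*ᴹ : ∀ {n} (A B : Matrix n) (A-ns : NonSingular A) (B-ns : NonSingular B) →
                (UpperTriangular A × UpperTriangular B) ⊎ (LowerTriangular A × LowerTriangular B) →
                combined (A *ᴹ B) (nonSingular-*ᴹ A B A-ns B-ns)
                  ≈ᴹ combined A A-ns *ᴹ combined B B-ns
  combined-*ᴹ {n} A B A-ns B-ns AB-same i j
    with A-tri , B-tri , AB-tri ← triangular-*ᴹ A B AB-same = begin
    combined (A *ᴹ B) (nonSingular-*ᴹ A B A-ns B-ns) i j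
      ≈⟨ combined-triangular (A *ᴹ B) (nonSingular-*ᴹ A B A-ns B-ns) AB-tri i j ⟩
    Iᴹ n i j
      ≈⟨ sum-Iᴹ (λ k → Iᴹ n k j) i ⟨
    (Iᴹ n *ᴹ Iᴹ n) i j
      ≈⟨ *ᴹ-cong (combined-triangular A A-ns A-tri) (combined-triangular B B-ns B-tri) i j ⟨
    (combined A A-ns *ᴹ combined B B-ns) i j ∎

  -- An eigenvector equation read at an entry apart from zero forces the eigenvalue to be one.
  -- Conversely the all-ones vector is an eigenvector; `NonZero n` supplies the index of its nonzero
  -- entry.
  eigenvalue-Iᴹ : ∀ {n} .{{_ : NonZero n}} {A : Matrix n} → A ≈ᴹ Iᴹ n → Eigenvalue A ≐ (_≈ 1#)
  eigenvalue-Iᴹ {n} {A = A} A≈I =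
      (λ (v , (i , vᵢ#0) , Av≈μv) → x*y≈y⇒x≈1 vᵢ#0 (trans (sym (Av≈μv i)) (Av≈v v i)))
    , (λ μ≈1 → (λ _ → 1#) , (fromℕ< (>-nonZero⁻¹ n) , 1#0) ,
               λ i → trans (Av≈v (λ _ → 1#) i) (sym (trans (*-congʳ μ≈1) (*-identityˡ 1#))))
    where
    Av≈v : ∀ v i → ∑[ j < n ] (A i j * v j) ≈ v i
    Av≈v v i = trans (sum-cong-≋ λ j → *-congʳ (A≈I i j)) (sum-Iᴹ v i)

module _ {a ℓ₁ ℓ₂ c m₁ m₂} {F : HeytingField a ℓ₁ ℓ₂} (L : Extension F c m₁ m₂) where

  open Extension L
  open HeytingField overfield using (trans)
  open RingMorphisms.IsRingHomomorphism embed-isRingHomomorphism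
  private
    module F = Matrices F
    module L = Matrices overfield

  embed-Iᴹ : ∀ {n} → map (map embed) (F.Iᴹ n) L.≈ᴹ L.Iᴹ n
  embed-Iᴹ i j with i ≟ j
  ... | yes _ = 1#-homo
  ... | no  _ = 0#-homo

  -- A ring homomorphism preserves zero and one, so the identity matrix stays the identity over the
  -- extension, where the spectrum is then computed.
  Λ-Iᴹ : ∀ {n} .{{_ : NonZero n}} {A : F.Matrix n} → A F.≈ᴹ F.Iᴹ n →
         Λ L A ≐ (λ μ → HeytingField._≈_ overfield μ (HeytingField.1# overfield))
  Λ-Iᴹ A≈I = MatrixProperties.eigenvalue-Iᴹ overfield
    λ i j → trans (⟦⟧-cong (A≈I i j)) (embed-Iᴹ i j)

proposition7 : ∀ {c ℓ₁ ℓ₂ d m₁ m₂} (K : NumberField c ℓ₁ ℓ₂) (n : ℕ) .{{_ : NonZero n}} →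
    let open Matrices (NumberField.heytingField K) in
    (∀ (T : Matrix n) (T-ns : NonSingular T) → Triangular T → combined T T-ns ≈ᴹ Iᴹ n)
    × (∀ (L : Extension (NumberField.heytingField K) d m₁ m₂) →
    let open HeytingField (Extension.overfield L) in
    ∀ (T : Matrix n) (T-ns : NonSingular T) → Triangular T → Λ L (combined T T-ns) ≐ (_≈ 1#))
    × (∀ (A B : Matrix n) (A-ns : NonSingular A) (B-ns : NonSingular B) →
    (UpperTriangular A × UpperTriangular B) ⊎ (LowerTriangular A × LowerTriangular B) →
    combined (A *ᴹ B) (nonSingular-*ᴹ A B A-ns B-ns) ≈ᴹ combined A A-ns *ᴹ combined B B-ns)
proposition7 K n =
    combined-triangular
  , (λ L T T-ns T-tri → Λ-Iᴹ L (combined-triangular T T-ns T-tri))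
  , combined-*ᴹ
  where open MatrixProperties (NumberField.heytingField K)
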